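{- The IncMax problem has a competitive ratio of at least $2.246$; that is, for every $\alpha<2.246$ there is an instance of IncMax that admits no $\alpha$-competitive (deterministic) solution.
   Context: IncMax. An instance is given by a countable set $U$ of elements and a monotone function $f:2^U\to\mathbb{R}_{\ge 0}$ (i.e. $f(X)\le f(Y)$ for $X\subseteq Y$) that is accountable: for every (finite non-empty) $X\subseteq U$ there exists $e\in X$ with $f(X\setminus\{e\})\ge f(X)-f(X)/|X|$. For $k\le n:=|U|$ (all $k\in\mathbb{N}$ if $U$ is infinite) let $\mathrm{Opt}(k)=\max\{f(X): X\subseteq U,\ |X|=k\}$ (assumed to exist). A deterministic solution is an order $\sigma=(e_1,e_2,\dots)$ of the elements of $U$; it is $\alpha$-competitive ($\alpha\ge1$) if $\mathrm{Opt}(k)\le\alpha\, f(\{e_1,\dots,e_k\})$ for all $k$. An algorithm is $\alpha$-competitive if it produces an $\alpha$-competitive solution for every instance; the competitive ratio of an algorithm is the infimum over all such $\alpha$, and the competitive ratio of the problem is the infimum over the competitive ratios of all algorithms. There is no computational restriction on algorithms, which have full knowledge of the instance. -}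

module Defs where

open import Data.Bool.Base using (Bool; T; not; _∧_)
open import Data.Fin.Base using (Fin; toℕ)
import Data.Fin.Properties as Fin
open import Data.Integer.Base using (+_)
open import Data.Nat.Base as ℕ using (ℕ; _⊔_; _<ᵇ_)
import Data.Nat.Properties as ℕ
open import Data.Product.Base using (∃; ∃-syntax; Σ; _×_; _,_)
open import Data.Rational.Base as ℚ using (ℚ; 0ℚ; 1ℚ; ½; Positive; ∣_∣; _/_; 1/_)
import Data.Rational.Properties as ℚ
open import Data.Rational.Solver using (module +-*-Solver)
open import Data.Unit.Base using (⊤)
open import Function.Bundles using (_↔_; Inverse)
open import Function.Properties.Inverse using (↔⇒↣; ↔-sym)
open import Relation.Binary.Definitions using (DecidableEquality)
open import Relation.Binary.PropositionalEquality
open import Relation.Nullary.Decidable using (⌊_⌋; via-injection)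

------------------------------------------------------------------------
-- Real numbers: Cauchy sequences of rationals. Two sequences denote the
-- same real number iff each is ≤ℝ the other.

IsCauchy : (ℕ → ℚ) → Set
IsCauchy s = ∀ ε → 0ℚ ℚ.< ε →
  ∃[ N ] (∀ m n → N ℕ.≤ m → N ℕ.≤ n → ∣ s m ℚ.- s n ∣ ℚ.≤ ε)

record ℝ : Set where
  constructor mkℝ
  field
    seq    : ℕ → ℚ
    cauchy : IsCauchy seq

open ℝ public

infix  4 _≤ℝ_ _<ℝ_
infixl 6 _-ℝ_
infixl 7 _*ℝ_ _/ℕ_

_≤ℝ_ : ℝ → ℝ → Set
x ≤ℝ y = ∀ ε → 0ℚ ℚ.< ε → ∃[ N ] (∀ n → N ℕ.≤ n → seq x n ℚ.≤ seq y n ℚ.+ ε)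

_<ℝ_ : ℝ → ℝ → Set
x <ℝ y = ∃[ ε ] (0ℚ ℚ.< ε × ∃[ N ] (∀ n → N ℕ.≤ n → seq x n ℚ.+ ε ℚ.≤ seq y n))

fromℚ : ℚ → ℝ
fromℚ q = mkℝ (λ _ → q) λ ε 0<ε → 0 , λ _ _ _ _ →
  subst (λ d → ∣ d ∣ ℚ.≤ ε) (sym (ℚ.+-inverseʳ q)) (ℚ.<⇒≤ 0<ε)

0ℝ 1ℝ : ℝ
0ℝ = fromℚ 0ℚ
1ℝ = fromℚ 1ℚ

private
  half>0 : ∀ {ε} → 0ℚ ℚ.< ε → 0ℚ ℚ.< ½ ℚ.* ε
  half>0 {ε} 0<ε = ℚ.positive⁻¹ (½ ℚ.* ε) {{ℚ.pos*pos⇒pos ½ ε {{ℚ.positive 0<ε}}}}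

  ∣+∣≤ : ∀ p q ε → ∣ p ∣ ℚ.≤ ½ ℚ.* ε → ∣ q ∣ ℚ.≤ ½ ℚ.* ε → ∣ p ℚ.+ q ∣ ℚ.≤ ε
  ∣+∣≤ p q ε p≤ q≤ = begin
    ∣ p ℚ.+ q ∣            ≤⟨ ℚ.∣p+q∣≤∣p∣+∣q∣ p q ⟩
    ∣ p ∣ ℚ.+ ∣ q ∣        ≤⟨ ℚ.+-mono-≤ p≤ q≤ ⟩
    ½ ℚ.* ε ℚ.+ ½ ℚ.* ε    ≡⟨ ℚ.*-distribʳ-+ ε ½ ½ ⟨
    1ℚ ℚ.* ε               ≡⟨ ℚ.*-identityˡ ε ⟩
    ε                      ∎
    where open ℚ.≤-Reasoning

  split : ∀ a b → a ≡ b ℚ.+ (a ℚ.- b)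
  split = solve 2 (λ a b → a := b :+ (a :- b)) refl
    where open +-*-Solver

  regroup-- : ∀ a b c d → (a ℚ.- b) ℚ.- (c ℚ.- d) ≡ (a ℚ.- c) ℚ.+ (d ℚ.- b)
  regroup-- = solve 4 (λ a b c d → (a :- b) :- (c :- d) := (a :- c) :+ (d :- b)) refl
    where open +-*-Solver

  regroup-* : ∀ a b c d → a ℚ.* b ℚ.- c ℚ.* d ≡ a ℚ.* (b ℚ.- d) ℚ.+ d ℚ.* (a ℚ.- c)
  regroup-* = solve 4 (λ a b c d → a :* b :- c :* d := a :* (b :- d) :+ d :* (a :- c)) refl
    where open +-*-Solver

  bounded : ∀ s → IsCauchy s →
            ∃[ B ] (Positive B × ∃[ N ] (∀ n → N ℕ.≤ n → ∣ s n ∣ ℚ.≤ B))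
  bounded s c =
    let N , close = c 1ℚ (ℚ.positive⁻¹ 1ℚ) in
    ∣ s N ∣ ℚ.+ 1ℚ ,
    ℚ.nonNeg+pos⇒pos ∣ s N ∣ {{ℚ.nonNegative (ℚ.0≤∣p∣ (s N))}} 1ℚ ,
    N , λ n N≤n → near (s n) (s N) (close n N N≤n ℕ.≤-refl)
    where
    near : ∀ p q → ∣ p ℚ.- q ∣ ℚ.≤ 1ℚ → ∣ p ∣ ℚ.≤ ∣ q ∣ ℚ.+ 1ℚ
    near p q p-q≤1 = begin
      ∣ p ∣                      ≡⟨ cong ∣_∣ (split p q) ⟩
      ∣ q ℚ.+ (p ℚ.- q) ∣        ≤⟨ ℚ.∣p+q∣≤∣p∣+∣q∣ q (p ℚ.- q) ⟩
      ∣ q ∣ ℚ.+ ∣ p ℚ.- q ∣      ≤⟨ ℚ.+-monoʳ-≤ ∣ q ∣ p-q≤1 ⟩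
      ∣ q ∣ ℚ.+ 1ℚ               ∎
      where open ℚ.≤-Reasoning

  scale : ∀ B → Positive B → ∀ ε → 0ℚ ℚ.< ε →
          ∃[ δ ] (0ℚ ℚ.< δ × (∀ t d → ∣ t ∣ ℚ.≤ B → ∣ d ∣ ℚ.≤ δ → ∣ t ℚ.* d ∣ ℚ.≤ ε))
  scale B B>0 ε 0<ε =
    1/B ℚ.* ε ,
    ℚ.positive⁻¹ (1/B ℚ.* ε)
      {{ℚ.pos*pos⇒pos 1/B {{ℚ.1/pos⇒pos B {{B>0}}}} ε {{ℚ.positive 0<ε}}}} ,
    bound
    where
    open ℚ.≤-Reasoning
    B≢0 = ℚ.pos⇒nonZero B {{B>0}}
    1/B = (1/ B) {{B≢0}}
    bound : ∀ t d → ∣ t ∣ ℚ.≤ B → ∣ d ∣ ℚ.≤ 1/B ℚ.* ε → ∣ t ℚ.* d ∣ ℚ.≤ ε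
    bound t d t≤B d≤δ = begin
      ∣ t ℚ.* d ∣            ≡⟨ ℚ.∣p*q∣≡∣p∣*∣q∣ t d ⟩
      ∣ t ∣ ℚ.* ∣ d ∣        ≤⟨ ℚ.*-monoʳ-≤-nonNeg ∣ d ∣ {{ℚ.nonNegative (ℚ.0≤∣p∣ d)}} t≤B ⟩
      B ℚ.* ∣ d ∣            ≤⟨ ℚ.*-monoˡ-≤-nonNeg B {{ℚ.pos⇒nonNeg B {{B>0}}}} d≤δ ⟩
      B ℚ.* (1/B ℚ.* ε)      ≡⟨ ℚ.*-assoc B 1/B ε ⟨
      B ℚ.* 1/B ℚ.* ε        ≡⟨ cong (ℚ._* ε) (ℚ.*-inverseʳ B {{B≢0}}) ⟩
      1ℚ ℚ.* ε               ≡⟨ ℚ.*-identityˡ ε ⟩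
      ε                      ∎

  minus-cauchy : ∀ s t → IsCauchy s → IsCauchy t → IsCauchy (λ n → s n ℚ.- t n)
  minus-cauchy s t cs ct ε 0<ε =
    let M , hs = cs (½ ℚ.* ε) (half>0 0<ε)
        N , ht = ct (½ ℚ.* ε) (half>0 0<ε)
    in M ⊔ N , λ m n p q →
      subst (λ z → ∣ z ∣ ℚ.≤ ε) (sym (regroup-- (s m) (t m) (s n) (t n)))
        (∣+∣≤ (s m ℚ.- s n) (t n ℚ.- t m) ε
          (hs m n (ℕ.m⊔n≤o⇒m≤o M N p) (ℕ.m⊔n≤o⇒m≤o M N q))
          (ht n m (ℕ.m⊔n≤o⇒n≤o M N q) (ℕ.m⊔n≤o⇒n≤o M N p)))

  times-cauchy : ∀ s t → IsCauchy s → IsCauchy t → IsCauchy (λ n → s n ℚ.* t n)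
  times-cauchy s t cs ct ε 0<ε =
    let A , A>0 , K , bs = bounded s cs
        B , B>0 , L , bt = bounded t ct
        δ , 0<δ , scaleA = scale A A>0 (½ ℚ.* ε) (half>0 0<ε)
        η , 0<η , scaleB = scale B B>0 (½ ℚ.* ε) (half>0 0<ε)
        M , hs = cs η 0<η
        N , ht = ct δ 0<δ
    in (K ⊔ L) ⊔ (M ⊔ N) , λ m n p q →
      let KL≤m = ℕ.m⊔n≤o⇒m≤o (K ⊔ L) (M ⊔ N) p
          KL≤n = ℕ.m⊔n≤o⇒m≤o (K ⊔ L) (M ⊔ N) q
          MN≤m = ℕ.m⊔n≤o⇒n≤o (K ⊔ L) (M ⊔ N) p
          MN≤n = ℕ.m⊔n≤o⇒n≤o (K ⊔ L) (M ⊔ N) q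
      in subst (λ z → ∣ z ∣ ℚ.≤ ε) (sym (regroup-* (s m) (t m) (s n) (t n)))
        (∣+∣≤ (s m ℚ.* (t m ℚ.- t n)) (t n ℚ.* (s m ℚ.- s n)) ε
          (scaleA (s m) (t m ℚ.- t n) (bs m (ℕ.m⊔n≤o⇒m≤o K L KL≤m))
            (ht m n (ℕ.m⊔n≤o⇒n≤o M N MN≤m) (ℕ.m⊔n≤o⇒n≤o M N MN≤n)))
          (scaleB (t n) (s m ℚ.- s n) (bt n (ℕ.m⊔n≤o⇒n≤o K L KL≤n))
            (hs m n (ℕ.m⊔n≤o⇒m≤o M N MN≤m) (ℕ.m⊔n≤o⇒m≤o M N MN≤n))))

_-ℝ_ : ℝ → ℝ → ℝ
x -ℝ y = mkℝ (λ n → seq x n ℚ.- seq y n) (minus-cauchy (seq x) (seq y) (cauchy x) (cauchy y))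

_*ℝ_ : ℝ → ℝ → ℝ
x *ℝ y = mkℝ (λ n → seq x n ℚ.* seq y n) (times-cauchy (seq x) (seq y) (cauchy x) (cauchy y))

_/ℕ_ : ℝ → (k : ℕ) .{{_ : ℕ.NonZero k}} → ℝ
x /ℕ k = x *ℝ fromℚ (+ 1 / k)

------------------------------------------------------------------------
-- Countable sets, their subsets, and finite cardinalities

data Cardinality : Set where
  fin : ℕ → Cardinality
  ω   : Cardinality

Index : Cardinality → Set
Index (fin n) = Fin n
Index ω       = ℕ

index# : ∀ {c} → Index c → ℕ
index# {fin n} i = toℕ i
index# {ω}     i = i

index-≟ : ∀ {c} → DecidableEquality (Index c)
index-≟ {fin n} = Fin._≟_
index-≟ {ω}     = ℕ._≟_

infix 4 _≤ᶜ_

_≤ᶜ_ : ℕ → Cardinality → Set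
k ≤ᶜ fin n = k ℕ.≤ n
k ≤ᶜ ω     = ⊤

-- 2^U, as characteristic functions.
𝒫 : Set → Set
𝒫 U = U → Bool

infix 4 _∈_ _⊆_

_∈_ : {U : Set} → U → 𝒫 U → Set
u ∈ X = T (X u)

_⊆_ : {U : Set} → 𝒫 U → 𝒫 U → Set
X ⊆ Y = ∀ u → u ∈ X → u ∈ Y

HasSize : {U : Set} → 𝒫 U → ℕ → Set
HasSize {U} X k = Fin k ↔ Σ U (_∈ X)

------------------------------------------------------------------------
-- IncMax

record Instance : Set₁ where
  field
    U    : Set
    size : Cardinality
    enum : Index size ↔ U
    f    : 𝒫 U → ℝ

  _≟_ : DecidableEquality U
  _≟_ = via-injection (↔⇒↣ (↔-sym enum)) index-≟

  infixl 6 _∖_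

  _∖_ : 𝒫 U → U → 𝒫 U
  (X ∖ e) u = X u ∧ not ⌊ u ≟ e ⌋

  field
    nonNegative : ∀ X → 0ℝ ≤ℝ f X
    monotone    : ∀ X Y → X ⊆ Y → f X ≤ℝ f Y
    accountable : ∀ X k .{{_ : ℕ.NonZero k}} → HasSize X k →
                  ∃[ e ] (e ∈ X × f X -ℝ f X /ℕ k ≤ℝ f (X ∖ e))
    maximiser   : ∀ k → k ≤ᶜ size →
                  ∃[ X ] (HasSize X k × (∀ Y → HasSize Y k → f Y ≤ℝ f X))

  Opt : ∀ k → k ≤ᶜ size → ℝ
  Opt k k≤n = let X , _ = maximiser k k≤n in f X

  -- An order (e₁, e₂, …) of all elements of U; e_{i+1} is the element at index i.
  Solution : Set
  Solution = Index size ↔ U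

  -- {e₁, …, e_k}
  prefix : Solution → ℕ → 𝒫 U
  prefix σ k u = index# (Inverse.from σ u) <ᵇ k

  Competitive : ℝ → Solution → Set
  Competitive α σ =
    1ℝ ≤ℝ α × (∀ k (k≤n : k ≤ᶜ size) → Opt k k≤n ≤ℝ α *ℝ f (prefix σ k))

{-# OPTIONS --safe #-}

-- Partition part of ℕ into regions R₀, …, R₁₆₁ of sizes s j and densities d j, and let f X be the largest d j |X ∩ R j|.
-- Region values grow by a factor just above 2.246, so at every time k some region must "serve", i.e. already have
-- worth Opt(k) / 2.246, and no region m can serve from time s (m+1) on. The sizes are chosen such that the serving
-- region can only advance one step at a time: switching from m to m+2 or later, or to m+1 before Opt has reached the
-- value of R m, would need more elements than are available, given that at least b m elements were already spent on
-- R₀, …, R (m-1). Hence every R m absorbs at least s m / 2.246 elements, these accumulate in b, and finally even the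
-- switch to the last region is impossible.

module Submission where

open import Defs
open import Data.Bool.Base using (Bool; true; false; T; not; _∧_)
open import Data.Bool.Properties using (T-∧; T-irrelevant)
open import Data.Empty using (⊥; ⊥-elim)
open import Data.Fin.Base using (Fin; toℕ; fromℕ<; punchOut)
open import Data.Fin.Properties
  using (toℕ<n; toℕ-fromℕ<; toℕ-injective; fromℕ<-injective; injective⇒≤; punchOut-injective; any?)
open import Data.Integer.Base as ℤ using (+_)
import Data.Integer.Properties as ℤ
open import Data.Nat.Base hiding (_/_)
open import Data.Nat.DivMod as ℕ using (/-monoˡ-≤; m*n/n≡m)
open import Data.Nat.Properties
open import Data.Nat.Solver using (module +-*-Solver)
open import Data.Product.Base using (∃-syntax; Σ; _×_; _,_; proj₁; proj₂)
open import Data.Rational.Base as ℚ using (0ℚ; _/_; toℚᵘ)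
import Data.Rational.Properties as ℚ
open import Data.Rational.Unnormalised.Base as ℚᵘ using (mkℚᵘ; *≤*)
import Data.Rational.Unnormalised.Properties as ℚᵘ
open import Data.Sum.Base using (_⊎_; inj₁; inj₂)
open import Function.Base using (_∘_)
open import Function.Bundles using (_↔_; Equivalence; Injection; Inverse; mk↔ₛ′)
open import Function.Construct.Identity using (↔-id)
open import Function.Properties.Inverse using (↔⇒↣; ↔-sym)
open import Relation.Binary.Definitions using (DecidableEquality; tri<; tri≈; tri>)
open import Relation.Binary.PropositionalEquality
open import Relation.Nullary using (Dec; yes; no; contradiction)
open import Relation.Nullary.Decidable using (⌊_⌋; _×-dec_; ¬?; from-yes; decidable-stable; via-injection)
open import Relation.Nullary.Negation.Core using (¬_)

private
  variable
    X Y : 𝒫 ℕ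
    k m n : ℕ

-- Counting members of subsets of ℕ

bit : Bool → ℕ
bit false = 0
bit true  = 1

count : 𝒫 ℕ → ℕ → ℕ
count X zero    = 0
count X (suc n) = bit (X n) + count X n

infixl 8 _↑_

_↑_ : 𝒫 ℕ → ℕ → 𝒫 ℕ
(X ↑ o) u = X (o + u)

bit≤1 : ∀ x → bit x ≤ 1
bit≤1 false = z≤n
bit≤1 true  = ≤-refl

bit-mono : ∀ x y → (T x → T y) → bit x ≤ bit y
bit-mono false y     _ = z≤n
bit-mono true  true  _ = ≤-refl
bit-mono true  false h = ⊥-elim (h _)

bit-true : ∀ x → T x → bit x ≡ 1
bit-true true _ = refl

count-monoˡ : ∀ n → (∀ u → u < n → u ∈ X → u ∈ Y) → count X n ≤ count Y n
count-monoˡ         zero    h = z≤n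
count-monoˡ {X} {Y} (suc n) h =
  +-mono-≤ (bit-mono (X n) (Y n) (h n ≤-refl)) (count-monoˡ n λ u u<n → h u (m≤n⇒m≤1+n u<n))

count-≤ : ∀ X n → count X n ≤ n
count-≤ X zero    = z≤n
count-≤ X (suc n) = +-mono-≤ (bit≤1 (X n)) (count-≤ X n)

count-+ : ∀ X o n → count X (o + n) ≡ count X o + count (X ↑ o) n
count-+ X o zero    = trans (cong (count X) (+-identityʳ o)) (sym (+-identityʳ (count X o)))
count-+ X o (suc n) = begin
  count X (o + suc n)                                     ≡⟨ cong (count X) (+-suc o n) ⟩
  bit (X (o + n)) + count X (o + n)                       ≡⟨ cong (_+_ (bit (X (o + n)))) (count-+ X o n) ⟩
  bit (X (o + n)) + (count X o + count (X ↑ o) n)         ≡⟨ swap (bit (X (o + n))) (count X o) (count (X ↑ o) n) ⟩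
  count X o + (bit (X (o + n)) + count (X ↑ o) n)         ∎
  where
  open ≡-Reasoning
  swap : ∀ a b c → a + (b + c) ≡ b + (a + c)
  swap = solve 3 (λ a b c → a :+ (b :+ c) := b :+ (a :+ c)) refl
    where open +-*-Solver

count-monoʳ : ∀ X → m ≤ n → count X m ≤ count X n
count-monoʳ {m} {n} X m≤n = begin
  count X m                                ≤⟨ m≤m+n (count X m) _ ⟩
  count X m + count (X ↑ m) (n ∸ m)        ≡⟨ count-+ X m (n ∸ m) ⟨
  count X (m + (n ∸ m))                    ≡⟨ cong (count X) (m+[n∸m]≡n m≤n) ⟩
  count X n                                ∎
  where open ≤-Reasoning

count-< : ∀ {u} → u ∈ X → u < n → count X u < count X n
count-< {X} {n} {u} u∈X u<n = begin-strict
  count X u              <⟨ n<1+n _ ⟩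
  1 + count X u          ≡⟨ cong (_+ count X u) (bit-true (X u) u∈X) ⟨
  count X (suc u)        ≤⟨ count-monoʳ X u<n ⟩
  count X n              ∎
  where open ≤-Reasoning

count-empty : ∀ n → (∀ u → u < n → ¬ u ∈ X) → count X n ≡ 0
count-empty     zero    h = refl
count-empty {X} (suc n) h with X n | h n ≤-refl
... | false | _  = count-empty n λ u u<n → h u (m≤n⇒m≤1+n u<n)
... | true  | ¬p = ⊥-elim (¬p _)

count-full : m ≤ n → (∀ u → u < m → u ∈ X) → m ≤ count X n
count-full {m} {n} {X} m≤n h = ≤-trans (full m h) (count-monoʳ X m≤n)
  where
  full : ∀ m → (∀ u → u < m → u ∈ X) → m ≤ count X m
  full zero    h = z≤n
  full (suc m) h = +-mono-≤ (≤-reflexive (sym (bit-true (X m) (h m ≤-refl))))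
                            (full m λ u u<m → h u (m≤n⇒m≤1+n u<m))

count-delete : ∀ e n → (∀ u → u ∈ X → u ≢ e → u ∈ Y) → count X n ≤ suc (count Y n)
count-delete         e zero    h = z≤n
count-delete {X} {Y} e (suc n) h with n ≟ e
... | yes refl = +-mono-≤ (bit≤1 (X n))
  (≤-trans (count-monoˡ n λ u u<n u∈X → h u u∈X (<⇒≢ u<n)) (m≤n+m _ (bit (Y n))))
... | no n≢e   = begin
  bit (X n) + count X n            ≤⟨ +-mono-≤ (bit-mono (X n) (Y n) λ n∈X → h n n∈X n≢e) (count-delete e n h) ⟩
  bit (Y n) + suc (count Y n)      ≡⟨ +-suc _ _ ⟩
  suc (bit (Y n) + count Y n)      ∎
  where open ≤-Reasoning

-- A pigeonhole argument by induction on `n`: a member found at `n` has its image punched out of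
-- `Fin (suc k)`, and the smaller members still inject into `Fin k`.
count-injection : ∀ n (g : ∀ u → u ∈ X → Fin k) →
  (∀ u v p q → g u p ≡ g v q → u ≡ v) → count X n ≤ k
count-injection {X} n g inj = go n (λ u _ → g u) (λ u v _ _ → inj u v)
  where
  go : ∀ n {k} (g : ∀ u → u < n → u ∈ X → Fin k) →
    (∀ u v u<n v<n p q → g u u<n p ≡ g v v<n q → u ≡ v) → count X n ≤ k
  go zero    g inj = z≤n
  go (suc n) g inj with X n in eq
  go (suc n) g inj | false = go n (λ u u<n → g u (m≤n⇒m≤1+n u<n)) (λ u v _ _ → inj u v _ _)
  go (suc n) {zero} g inj | true with () ← g n ≤-refl (subst T (sym eq) _)
  go (suc n) {suc k} g inj | true = s≤s (go n
      (λ u u<n p → punchOut (apart u u<n p))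
      (λ u v u<n v<n p q e → inj u v _ _ p q (punchOut-injective (apart u u<n p) (apart v v<n q) e)))
    where
    n∈X : n ∈ X
    n∈X = subst T (sym eq) _
    apart : ∀ u (u<n : u < n) p → g n ≤-refl n∈X ≢ g u (m≤n⇒m≤1+n u<n) p
    apart u u<n p e = <⇒≢ u<n (sym (inj n u _ _ n∈X p e))

-- Cardinalities of subsets and intervals of ℕ

∈-≡ : {x y : Σ ℕ (_∈ X)} → proj₁ x ≡ proj₁ y → x ≡ y
∈-≡ {x = u , p} {_ , q} refl = cong (u ,_) (T-irrelevant p q)

hasSize⇒count≤ : HasSize X k → ∀ n → count X n ≤ k
hasSize⇒count≤ |X|=k n = count-injection n (λ u p → from (u , p))
    (λ u v p q e → cong proj₁ (from-injective e))
  where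
  open Inverse |X|=k using (from)
  from-injective = Injection.injective (↔⇒↣ (↔-sym |X|=k))

-- The rank of a member, i.e. the number of smaller members, is strictly increasing, hence
-- injective.
hasSize⇒≤count : HasSize X k → (∀ u → u ∈ X → u < n) → k ≤ count X n
hasSize⇒≤count {X} {k} {n} |X|=k bound = injective⇒≤ {f = rank} rank-injective
  where
  open Inverse |X|=k using (to)
  elt : Fin k → ℕ
  elt i = proj₁ (to i)
  elt∈ : ∀ i → elt i ∈ X
  elt∈ i = proj₂ (to i)
  rank : Fin k → Fin (count X n)
  rank i = fromℕ< (count-< {X} (elt∈ i) (bound _ (elt∈ i)))
  elt-injective : ∀ {i j} → elt i ≡ elt j → i ≡ j
  elt-injective e = Injection.injective (↔⇒↣ |X|=k) (∈-≡ e)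
  rank-injective : ∀ {i j} → rank i ≡ rank j → i ≡ j
  rank-injective {i} {j} e with <-cmp (elt i) (elt j) | fromℕ<-injective _ _ _ _ e
  ... | tri< i<j _ _ | e′ = contradiction e′ (<⇒≢ (count-< {X} (elt∈ i) i<j))
  ... | tri≈ _ i≡j _ | _  = elt-injective i≡j
  ... | tri> _ _ j<i | e′ = contradiction (sym e′) (<⇒≢ (count-< {X} (elt∈ j) j<i))

interval : ℕ → ℕ → 𝒫 ℕ
interval o k u = (o ≤ᵇ u) ∧ (u <ᵇ o + k)

∈-interval : ∀ {o k u} → o ≤ u → u < o + k → u ∈ interval o k
∈-interval o≤u u<o+k = Equivalence.from T-∧ (≤⇒≤ᵇ o≤u , <⇒<ᵇ u<o+k)

interval-hasSize : ∀ o k → HasSize (interval o k) k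
interval-hasSize o k = mk↔ₛ′ to from to∘from from∘to
  where
  low : ∀ {u} → u ∈ interval o k → o ≤ u
  low {u} p = ≤ᵇ⇒≤ o u (proj₁ (Equivalence.to (T-∧ {o ≤ᵇ u}) p))
  high : ∀ {u} → u ∈ interval o k → u ∸ o < k
  high {u} p = +-cancelˡ-< o _ _ (subst (_< o + k) (sym (m+[n∸m]≡n (low p)))
                 (<ᵇ⇒< u (o + k) (proj₂ (Equivalence.to (T-∧ {o ≤ᵇ u}) p))))
  to : Fin k → Σ ℕ (_∈ interval o k)
  to i = o + toℕ i , ∈-interval (m≤m+n o (toℕ i)) (+-monoʳ-< o (toℕ<n i))
  from : Σ ℕ (_∈ interval o k) → Fin k
  from (u , p) = fromℕ< (high p)
  to∘from : ∀ x → to (from x) ≡ x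
  to∘from (u , p) = ∈-≡ (trans (cong (_+_ o) (toℕ-fromℕ< (high p))) (m+[n∸m]≡n (low p)))
  from∘to : ∀ i → from (to i) ≡ i
  from∘to i = toℕ-injective (trans (toℕ-fromℕ< _) (m+n∸m≡n o (toℕ i)))

-- Maxima of finite sequences

maximum : (ℕ → ℕ) → ℕ → ℕ
maximum g zero    = g 0
maximum g (suc n) = maximum g n ⊔ g (suc n)

maximum-upper : ∀ g {i n} → i ≤ n → g i ≤ maximum g n
maximum-upper g {i} {n} i≤n with m≤n⇒m<n∨m≡n i≤n
maximum-upper g {n = zero}  _ | inj₂ refl = ≤-refl
maximum-upper g {n = suc n} _ | inj₂ refl = m≤n⊔m (maximum g n) _
maximum-upper g {n = suc n} _ | inj₁ i<n  = ≤-trans (maximum-upper g (s≤s⁻¹ i<n)) (m≤m⊔n _ _)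

maximum-attained : ∀ g n → ∃[ i ] (i ≤ n × maximum g n ≡ g i)
maximum-attained g zero    = 0 , z≤n , refl
maximum-attained g (suc n) with ⊔-sel (maximum g n) (g (suc n)) | maximum-attained g n
... | inj₁ e | i , i≤n , e′ = i , m≤n⇒m≤1+n i≤n , trans e e′
... | inj₂ e | _            = suc n , ≤-refl , e

-- Natural numbers as reals

fromℕ : ℕ → ℝ
fromℕ n = fromℚ (+ n / 1)

toℚᵘ-fromℕ : ∀ n → toℚᵘ (+ n / 1) ℚᵘ.≃ mkℚᵘ (+ n) 0
toℚᵘ-fromℕ n = ℚ.toℚᵘ-fromℚᵘ (mkℚᵘ (+ n) 0)

≤-fromℚ : ∀ {p q} → p ℚ.≤ q → fromℚ p ≤ℝ fromℚ q
≤-fromℚ {p} {q} p≤q ε 0<ε = 0 , λ _ _ → begin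
  p           ≤⟨ p≤q ⟩
  q           ≡⟨ ℚ.+-identityʳ q ⟨
  q ℚ.+ 0ℚ    ≤⟨ ℚ.+-monoʳ-≤ q (ℚ.<⇒≤ 0<ε) ⟩
  q ℚ.+ ε     ∎
  where open ℚ.≤-Reasoning

ℕ≤⇒ℚ≤ : m ≤ n → (+ m / 1) ℚ.≤ (+ n / 1)
ℕ≤⇒ℚ≤ {m} {n} m≤n = ℚ.toℚᵘ-cancel-≤ (begin
  toℚᵘ (+ m / 1)    ≃⟨ toℚᵘ-fromℕ m ⟩
  mkℚᵘ (+ m) 0      ≤⟨ *≤* (ℤ.*-monoʳ-≤-nonNeg (+ 1) (ℤ.+≤+ m≤n)) ⟩
  mkℚᵘ (+ n) 0      ≃⟨ toℚᵘ-fromℕ n ⟨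
  toℚᵘ (+ n / 1)    ∎)
  where open ℚᵘ.≤-Reasoning

fromℕ-mono : ∀ m n → m ≤ n → fromℕ m ≤ℝ fromℕ n
fromℕ-mono m n m≤n = ≤-fromℚ (ℕ≤⇒ℚ≤ {m} {n} m≤n)

-- Accountability in integer terms: `δ` is the loss from a deletion, and `δ * k ≤ v` bounds it by
-- the average share `v / k`.
share-≤ : ∀ v w δ k .{{_ : NonZero k}} → v ≤ w + δ → δ * k ≤ v →
  fromℕ v -ℝ fromℕ v /ℕ k ≤ℝ fromℕ w
share-≤ v w δ (suc k) v≤w+δ δk≤v = ≤-fromℚ (begin
  V ℚ.- V ℚ.* 1/k                              ≤⟨ ℚ.+-monoˡ-≤ (ℚ.- (V ℚ.* 1/k)) V≤ ⟩
  W ℚ.+ V ℚ.* 1/k ℚ.- V ℚ.* 1/k                ≡⟨ ℚ.+-assoc W _ _ ⟩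
  W ℚ.+ (V ℚ.* 1/k ℚ.- V ℚ.* 1/k)              ≡⟨ cong (ℚ._+_ W) (ℚ.+-inverseʳ (V ℚ.* 1/k)) ⟩
  W ℚ.+ 0ℚ                                     ≡⟨ ℚ.+-identityʳ W ⟩
  W                                            ∎)
  where
  open ℚ.≤-Reasoning
  V = + v / 1
  W = + w / 1
  1/k = + 1 / suc k
  -- The extra zeros match the forms to which the denominators in `Vᵘ≤` compute.
  vk≤ : v * suc (k + 0 + 0) ≤ w * suc (k + 0) + v
  vk≤ = subst (λ j → v * suc (j + 0) ≤ w * suc j + v) (sym (+-identityʳ k))
    (subst (λ j → v * suc j ≤ w * suc k + v) (sym (+-identityʳ k))
      (≤-trans (*-monoˡ-≤ (suc k) v≤w+δ)
        (≤-trans (≤-reflexive (*-distribʳ-+ (suc k) w δ)) (+-monoʳ-≤ (w * suc k) δk≤v))))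
  Vᵘ≤ : mkℚᵘ (+ v) 0 ℚᵘ.≤ mkℚᵘ (+ w) 0 ℚᵘ.+ mkℚᵘ (+ v) 0 ℚᵘ.* mkℚᵘ (+ 1) k
  Vᵘ≤ = *≤* (ℤR.begin
      + v ℤ.* + suc (k + 0 + 0)                    ℤR.≡⟨ ℤ.pos-* v _ ⟨
      + (v * suc (k + 0 + 0))                      ℤR.≤⟨ ℤ.+≤+ vk≤ ⟩
      + (w * suc (k + 0)) ℤ.+ + v
        ℤR.≡⟨ cong₂ ℤ._+_ (ℤ.pos-* w _) (sym (trans (ℤ.*-identityʳ _) (ℤ.*-identityʳ (+ v)))) ⟩
      + w ℤ.* + suc (k + 0) ℤ.+ + v ℤ.* + 1 ℤ.* + 1             ℤR.≡⟨ ℤ.*-identityʳ _ ⟨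
      (+ w ℤ.* + suc (k + 0) ℤ.+ + v ℤ.* + 1 ℤ.* + 1) ℤ.* + 1   ℤR.∎)
    where module ℤR = ℤ.≤-Reasoning
  V≤ : V ℚ.≤ W ℚ.+ V ℚ.* 1/k
  V≤ = ℚ.toℚᵘ-cancel-≤ (R.begin
      toℚᵘ V R.≃⟨ toℚᵘ-fromℕ v ⟩
      mkℚᵘ (+ v) 0 R.≤⟨ Vᵘ≤ ⟩
      mkℚᵘ (+ w) 0 ℚᵘ.+ mkℚᵘ (+ v) 0 ℚᵘ.* mkℚᵘ (+ 1) k
        R.≃⟨ ℚᵘ.+-cong (toℚᵘ-fromℕ w) (ℚᵘ.*-cong (toℚᵘ-fromℕ v) (ℚ.toℚᵘ-fromℚᵘ (mkℚᵘ (+ 1) k))) ⟨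
      toℚᵘ W ℚᵘ.+ toℚᵘ V ℚᵘ.* toℚᵘ 1/k R.≃⟨ ℚᵘ.+-congʳ (toℚᵘ W) (ℚ.toℚᵘ-homo-* V 1/k) ⟨
      toℚᵘ W ℚᵘ.+ toℚᵘ (V ℚ.* 1/k) R.≃⟨ ℚ.toℚᵘ-homo-+ W (V ℚ.* 1/k) ⟨
      toℚᵘ (W ℚ.+ V ℚ.* 1/k) R.∎)
    where module R = ℚᵘ.≤-Reasoning


ratio-≤ : ∀ α v w → α <ℝ fromℚ (+ 2246 / 1000) → fromℕ v ≤ℝ α *ℝ fromℕ w → 1000 * v ≤ 2246 * w
ratio-≤ α v w (δ , 0<δ , N₁ , α+δ≤) v≤αw = ≮⇒≥ impossible
  where
  -- If the integer inequality failed, `v` would exceed `2.246 * w` by at least 1/1000; a tolerance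
  -- of half that is small enough to refute this.
  ε = + 1 / 2000
  0<ε : 0ℚ ℚ.< ε
  0<ε = ℚ.positive⁻¹ ε
  N₂ = proj₁ (v≤αw ε 0<ε)
  n₀ = N₁ ⊔ N₂
  αₙ = seq α n₀
  αₙ≤ : αₙ ℚ.≤ + 2246 / 1000
  αₙ≤ = begin
    αₙ              ≡⟨ ℚ.+-identityʳ αₙ ⟨
    αₙ ℚ.+ 0ℚ       ≤⟨ ℚ.+-monoʳ-≤ αₙ (ℚ.<⇒≤ 0<δ) ⟩
    αₙ ℚ.+ δ        ≤⟨ α+δ≤ n₀ (m≤m⊔n N₁ N₂) ⟩
    + 2246 / 1000   ∎
    where open ℚ.≤-Reasoning
  V≤ : + v / 1 ℚ.≤ (+ 2246 / 1000) ℚ.* (+ w / 1) ℚ.+ ε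
  V≤ = begin
    + v / 1                               ≤⟨ proj₂ (v≤αw ε 0<ε) n₀ (m≤n⊔m N₁ N₂) ⟩
    αₙ ℚ.* (+ w / 1) ℚ.+ ε
      ≤⟨ ℚ.+-monoˡ-≤ ε (ℚ.*-monoʳ-≤-nonNeg (+ w / 1) {{ℚ.nonNegative (ℕ≤⇒ℚ≤ {0} {w} z≤n)}} αₙ≤) ⟩
    (+ 2246 / 1000) ℚ.* (+ w / 1) ℚ.+ ε   ∎
    where open ℚ.≤-Reasoning
  Vᵘ≤ : mkℚᵘ (+ v) 0 ℚᵘ.≤ mkℚᵘ (+ 2246) 999 ℚᵘ.* mkℚᵘ (+ w) 0 ℚᵘ.+ mkℚᵘ (+ 1) 1999
  Vᵘ≤ = R.begin
      mkℚᵘ (+ v) 0 R.≃⟨ toℚᵘ-fromℕ v ⟨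
      toℚᵘ (+ v / 1) R.≤⟨ ℚ.toℚᵘ-mono-≤ V≤ ⟩
      toℚᵘ (ρ ℚ.* (+ w / 1) ℚ.+ ε) R.≃⟨ ℚ.toℚᵘ-homo-+ (ρ ℚ.* (+ w / 1)) ε ⟩
      toℚᵘ (ρ ℚ.* (+ w / 1)) ℚᵘ.+ toℚᵘ ε R.≃⟨ ℚᵘ.+-congˡ (toℚᵘ ε) (ℚ.toℚᵘ-homo-* ρ (+ w / 1)) ⟩
      toℚᵘ ρ ℚᵘ.* toℚᵘ (+ w / 1) ℚᵘ.+ toℚᵘ ε
        R.≃⟨ ℚᵘ.+-cong (ℚᵘ.*-cong (ℚ.toℚᵘ-fromℚᵘ (mkℚᵘ (+ 2246) 999)) (toℚᵘ-fromℕ w)) (ℚ.toℚᵘ-fromℚᵘ (mkℚᵘ (+ 1) 1999)) ⟩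
      mkℚᵘ (+ 2246) 999 ℚᵘ.* mkℚᵘ (+ w) 0 ℚᵘ.+ mkℚᵘ (+ 1) 1999 R.∎
    where
    module R = ℚᵘ.≤-Reasoning
    ρ = + 2246 / 1000
  v≤ : v * 2000000 ≤ 2246 * w * 2000 + 1000
  v≤ = ℤ.drop‿+≤+ (ℤR.begin
      + (v * 2000000)                                             ℤR.≡⟨ ℤ.pos-* v _ ⟩
      + v ℤ.* + 2000000                                           ℤR.≤⟨ ℚᵘ.drop-*≤* Vᵘ≤ ⟩
      (+ 2246 ℤ.* + w ℤ.* + 2000 ℤ.+ + 1000) ℤ.* + 1              ℤR.≡⟨ ℤ.*-identityʳ _ ⟩
      + 2246 ℤ.* + w ℤ.* + 2000 ℤ.+ + 1000
        ℤR.≡⟨ cong (ℤ._+ + 1000) (cong (ℤ._* + 2000) (ℤ.pos-* 2246 w)) ⟨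
      + (2246 * w) ℤ.* + 2000 ℤ.+ + 1000                          ℤR.≡⟨ cong (ℤ._+ + 1000) (ℤ.pos-* (2246 * w) 2000) ⟨
      + (2246 * w * 2000) ℤ.+ + 1000                              ℤR.∎)
    where module ℤR = ℤ.≤-Reasoning
  impossible : ¬ (2246 * w < 1000 * v)
  impossible 2246w<1000v = <⇒≱ (+-monoʳ-< (2246 * w * 2000) 1000<2000) (begin
    2246 * w * 2000 + 2000     ≡⟨ +-comm (2246 * w * 2000) 2000 ⟩
    suc (2246 * w) * 2000      ≤⟨ *-monoˡ-≤ 2000 2246w<1000v ⟩
    1000 * v * 2000            ≡⟨ cong (_* 2000) (*-comm 1000 v) ⟩
    v * 1000 * 2000            ≡⟨ *-assoc v 1000 2000 ⟩
    v * 2000000                ≤⟨ v≤ ⟩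
    2246 * w * 2000 + 1000     ∎)
    where
    open ≤-Reasoning
    1000<2000 : 1000 < 2000
    1000<2000 = <ᵇ⇒< 1000 2000 _

-- Instances whose objective is the value of the best of finitely many disjoint regions

module Regions (N : ℕ) (s d : ℕ → ℕ) where

  -- Region `j` occupies the positions from `offset j` up to, but excluding, `offset (suc j)`;
  -- elements from `offset (suc N)` on contribute nothing to the objective.
  offset : ℕ → ℕ
  offset zero    = 0
  offset (suc j) = offset j + s j

  offset-mono : m ≤ n → offset m ≤ offset n
  offset-mono {m} {n} m≤n with m≤n⇒m<n∨m≡n m≤n
  offset-mono             _ | inj₂ refl = ≤-refl
  offset-mono {n = suc n} _ | inj₁ m<n  = ≤-trans (offset-mono (s≤s⁻¹ m<n)) (m≤m+n (offset n) (s n))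

  s≤offset : ∀ {j} → j < n → s j ≤ offset n
  s≤offset {j = j} j<n = ≤-trans (m≤n+m (s j) (offset j)) (offset-mono j<n)

  hits : 𝒫 ℕ → ℕ → ℕ
  hits X j = count (X ↑ offset j) (s j)

  hits-mono : (∀ u → u ∈ X → u ∈ Y) → ∀ j → hits X j ≤ hits Y j
  hits-mono X⊆Y j = count-monoˡ (s j) λ u _ → X⊆Y (offset j + u)

  count-offset : ∀ X j → count X (offset (suc j)) ≡ count X (offset j) + hits X j
  count-offset X j = count-+ X (offset j) (s j)

  hits≤count : ∀ X j → hits X j ≤ count X (offset (suc j))
  hits≤count X j = ≤-trans (m≤n+m _ _) (≤-reflexive (sym (count-offset X j)))

  worth : 𝒫 ℕ → ℕ → ℕ
  worth X j = d j * hits X j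

  value : 𝒫 ℕ → ℕ
  value X = maximum (worth X) N

  value-mono : (∀ u → u ∈ X → u ∈ Y) → value X ≤ value Y
  value-mono {X} {Y} X⊆Y = let j , j≤N , e = maximum-attained (worth X) N in
    ≤-trans (≤-reflexive e) (≤-trans (*-monoʳ-≤ (d j) (hits-mono X⊆Y j)) (maximum-upper (worth Y) j≤N))

  -- The most that `k` elements can be worth in region `j`; the maximum over `j ≤ N` is Opt(k).
  capacity : ℕ → ℕ → ℕ
  capacity k j = d j * (k ⊓ s j)

  value≤capacity : HasSize X k → value X ≤ maximum (capacity k) N
  value≤capacity {X} {k} |X|=k = let j , j≤N , e = maximum-attained (worth X) N in begin
    value X                     ≡⟨ e ⟩
    d j * hits X j
      ≤⟨ *-monoʳ-≤ (d j) (⊓-glb (≤-trans (hits≤count X j) (hasSize⇒count≤ |X|=k (offset (suc j))))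
                                                          (count-≤ (X ↑ offset j) (s j))) ⟩
    capacity k j                ≤⟨ maximum-upper (capacity k) j≤N ⟩
    maximum (capacity k) N      ∎
    where open ≤-Reasoning

  -- The interval starts at the region of largest capacity and may run past its end, since a
  -- maximiser must have exactly `k` elements.
  block : ℕ → 𝒫 ℕ
  block k = interval (offset (proj₁ (maximum-attained (capacity k) N))) k

  block-hasSize : ∀ k → HasSize (block k) k
  block-hasSize k = interval-hasSize (offset (proj₁ (maximum-attained (capacity k) N))) k

  capacity≤value-block : ∀ k → maximum (capacity k) N ≤ value (block k)
  capacity≤value-block k = let j , j≤N , e = maximum-attained (capacity k) N in begin
    maximum (capacity k) N      ≡⟨ e ⟩
    d j * (k ⊓ s j)             ≤⟨ *-monoʳ-≤ (d j) (count-full (m⊓n≤n k (s j)) λ u u<m →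
                                     ∈-interval (m≤m+n (offset j) u)
                                       (+-monoʳ-< (offset j) (<-≤-trans u<m (m⊓n≤m k (s j))))) ⟩
    worth (block k) j           ≤⟨ maximum-upper (worth (block k)) j≤N ⟩
    value (block k)             ∎
    where open ≤-Reasoning

  -- If X is not inside the best region, some element can be removed for free;
  -- otherwise |X| ≤ hits X j and any element costs only d j.
  value-delete : ∀ X k .{{_ : NonZero k}} → HasSize X k →
    ∃[ e ] (e ∈ X × (∀ Y → (∀ u → u ∈ X → u ≢ e → u ∈ Y) →
      ∃[ δ ] (value X ≤ value Y + δ × δ * k ≤ value X)))
  value-delete X k@(suc _) |X|=k with maximum-attained (worth X) N
  ... | j , j≤N , vX≡ = remove (any? λ i → ¬? (inside? (proj₁ (to i))))
    where
    open Inverse |X|=k using (to; from; strictlyInverseˡ)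
    open ≤-Reasoning
    Inside : ℕ → Set
    Inside u = offset j ≤ u × u < offset (suc j)
    inside? : ∀ u → Dec (Inside u)
    inside? u = (offset j ≤? u) ×-dec (u <? offset (suc j))
    remove : Dec (∃[ i ] ¬ Inside (proj₁ (to i))) → _
    remove (yes (i , outside)) = e , proj₂ (to i) , λ Y X∖e⊆Y → 0 , (begin
      value X              ≡⟨ vX≡ ⟩
      worth X j            ≤⟨ *-monoʳ-≤ (d j) (count-monoˡ (s j) λ u u<s p → X∖e⊆Y _ p (away u u<s)) ⟩
      worth Y j            ≤⟨ maximum-upper (worth Y) j≤N ⟩
      value Y              ≡⟨ +-identityʳ _ ⟨
      value Y + 0          ∎) , z≤n
      where
      e : ℕ
      e = proj₁ (to i)
      away : ∀ u → u < s j → offset j + u ≢ e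
      away u u<s eq = outside (subst Inside eq (m≤m+n (offset j) u , +-monoʳ-< (offset j) u<s))
    remove (no none) = e , proj₂ (to Fin.zero) , λ Y X∖e⊆Y → d j , (begin
      value X              ≡⟨ vX≡ ⟩
      worth X j            ≤⟨ *-monoʳ-≤ (d j) (count-delete (e ∸ offset j) (s j) λ u p u≢ → X∖e⊆Y _ p (away u u≢)) ⟩
      d j * suc (hits Y j) ≡⟨ *-suc (d j) (hits Y j) ⟩
      d j + worth Y j      ≡⟨ +-comm (d j) (worth Y j) ⟩
      worth Y j + d j      ≤⟨ +-monoˡ-≤ (d j) (maximum-upper (worth Y) j≤N) ⟩
      value Y + d j        ∎) , (begin
      d j * k              ≤⟨ *-monoʳ-≤ (d j) k≤hits ⟩
      worth X j            ≡⟨ vX≡ ⟨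
      value X              ∎)
      where
      e : ℕ
      e = proj₁ (to Fin.zero)
      away : ∀ u → u ≢ e ∸ offset j → offset j + u ≢ e
      away u u≢ eq = u≢ (trans (sym (m+n∸m≡n (offset j) u)) (cong (_∸ offset j) eq))
      inside : ∀ u → u ∈ X → Inside u
      inside u p = subst Inside (cong proj₁ (strictlyInverseˡ (u , p)))
        (decidable-stable (inside? _) λ out → none (from (u , p) , out))
      k≤hits : k ≤ hits X j
      k≤hits = begin
        k                                   ≤⟨ hasSize⇒≤count |X|=k (λ u p → proj₂ (inside u p)) ⟩
        count X (offset (suc j))            ≡⟨ count-offset X j ⟩
        count X (offset j) + hits X j       ≡⟨ cong (λ c → c + hits X j) (count-empty (offset j)
                                                 λ u u<o p → <⇒≱ u<o (proj₁ (inside u p))) ⟩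
        hits X j                            ∎

  regions : Instance
  regions = record
    { U           = ℕ
    ; size        = ω
    ; enum        = ↔-id ℕ
    ; f           = fromℕ ∘ value
    ; nonNegative = λ X → fromℕ-mono 0 (value X) z≤n
    ; monotone    = λ X Y X⊆Y → fromℕ-mono (value X) (value Y) (value-mono X⊆Y)
    ; accountable = λ X k |X|=k →
        let e , e∈X , lose = value-delete X k |X|=k
            δ , vX≤ , δk≤ = lose (X ∖ e) λ u → ∈-delete (u ≟ᵤ e)
        in e , e∈X , share-≤ (value X) (value (X ∖ e)) δ k vX≤ δk≤
    ; maximiser   = λ k _ → block k , block-hasSize k ,
        λ Y |Y|=k → fromℕ-mono (value Y) (value (block k)) (≤-trans (value≤capacity |Y|=k) (capacity≤value-block k))
    }
    where
    -- Copies of the equality test and the deletion derived in `Instance`, so that `X ∖ e` is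
    -- definitionally the set in the accountability condition.
    _≟ᵤ_ : DecidableEquality ℕ
    _≟ᵤ_ = via-injection (↔⇒↣ (↔-sym (↔-id ℕ))) (index-≟ {ω})
    _∖_ : 𝒫 ℕ → ℕ → 𝒫 ℕ
    (X ∖ e) u = X u ∧ not ⌊ u ≟ᵤ e ⌋
    ∈-delete : ∀ {x} {P : Set} (P? : Dec P) → T x → ¬ P → T (x ∧ not ⌊ P? ⌋)
    ∈-delete (yes p) _  ¬p = contradiction p ¬p
    ∈-delete (no _)  Tx _  = Equivalence.from T-∧ (Tx , _)

  module _ (σ : ℕ ↔ ℕ) where
    open Instance regions using (prefix)

    prefix-grows : ∀ k u → u ∈ prefix σ k → u ∈ prefix σ (suc k)
    prefix-grows k u p = <⇒<ᵇ (m≤n⇒m≤1+n (<ᵇ⇒< _ k p))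

    count-prefix-≤ : ∀ k n → count (prefix σ k) n ≤ k
    count-prefix-≤ k n = count-injection n (λ u p → fromℕ< (<ᵇ⇒< (from u) k p))
      (λ u v _ _ e → from-injective (fromℕ<-injective _ _ _ _ e))
      where
      open Inverse σ using (from)
      from-injective = Injection.injective (↔⇒↣ (↔-sym σ))

    -- Opt(k) is at least every capacity, so competitiveness turns into an inequality between
    -- natural numbers that no longer mentions `α`.
    capacity≤value-prefix : ∀ α → α <ℝ fromℚ (+ 2246 / 1000) → Instance.Competitive regions α σ →
      ∀ k j → j ≤ N → 1000 * capacity k j ≤ 2246 * value (prefix σ k)
    capacity≤value-prefix α α< (_ , competitive) k j j≤N = ≤-trans
      (*-monoʳ-≤ 1000 (≤-trans (maximum-upper (capacity k) j≤N) (capacity≤value-block k)))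
      (ratio-≤ α (value (block k)) (value (prefix σ k)) α< (competitive k _))

-- Chains of regions that trap every order of the elements

-- The gap between the two sides is affine in `k`: if `p ≤ q` it does not shrink going up from `lo`,
-- and otherwise it does not shrink going down from `hi`.
linear-between : ∀ p q u v {lo hi} k → lo ≤ k → k ≤ hi →
  p * lo + u < q * lo + v → p * hi + u < q * hi + v → p * k + u < q * k + v
linear-between p q u v {lo} {hi} k lo≤k k≤hi at-lo at-hi with ≤-total p q
... | inj₁ p≤q = begin-strict
  p * k + u                            ≡⟨ cong (λ k → p * k + u) (m+[n∸m]≡n lo≤k) ⟨
  p * (lo + t) + u                     ≡⟨ expand p lo t u ⟩
  (p * lo + u) + p * t                 <⟨ +-mono-<-≤ at-lo (*-monoˡ-≤ t p≤q) ⟩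
  (q * lo + v) + q * t                 ≡⟨ expand q lo t v ⟨
  q * (lo + t) + v                     ≡⟨ cong (λ k → q * k + v) (m+[n∸m]≡n lo≤k) ⟩
  q * k + v                            ∎
  where
  open ≤-Reasoning
  t = k ∸ lo
  expand : ∀ p lo t u → p * (lo + t) + u ≡ (p * lo + u) + p * t
  expand = solve 4 (λ p lo t u → p :* (lo :+ t) :+ u := (p :* lo :+ u) :+ p :* t) refl
    where open +-*-Solver
... | inj₂ q≤p = +-cancelʳ-< (p * t) _ _ (begin-strict
  (p * k + u) + p * t                  ≡⟨ expand p k t u ⟨
  p * (k + t) + u                      ≡⟨ cong (λ k → p * k + u) (m+[n∸m]≡n k≤hi) ⟩
  p * hi + u                           <⟨ at-hi ⟩
  q * hi + v                           ≡⟨ cong (λ k → q * k + v) (m+[n∸m]≡n k≤hi) ⟨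
  q * (k + t) + v                      ≡⟨ expand q k t v ⟩
  (q * k + v) + q * t                  ≤⟨ +-monoʳ-≤ (q * k + v) (*-monoˡ-≤ t q≤p) ⟩
  (q * k + v) + p * t                  ∎)
  where
  open ≤-Reasoning
  t = hi ∸ k
  expand : ∀ p k t u → p * (k + t) + u ≡ (p * k + u) + p * t
  expand = solve 4 (λ p k t u → p :* (k :+ t) :+ u := (p :* k :+ u) :+ p :* t) refl
    where open +-*-Solver

module Chain (a c : ℕ) (s d b : ℕ → ℕ) where

  -- Suppose that at time k region m, and at time k + 1 region j, is within a/c of the optimum, while
  -- the optimum is at least d i * k and d i * (k + 1). Together they need c d_i k / (a d_m) and
  -- c d_i (k + 1) / (a d_j) elements, which with b m earlier ones exceeds k + 1.
  BlockedAt : ℕ → ℕ → ℕ → ℕ → Set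
  BlockedAt k m i j =
    a * d m * d j * suc k < a * d m * d j * b m + c * d i * (d j + d m) * k + c * d i * d m

  -- Both sides of `BlockedAt` are affine in `k`, so the two ends decide the whole range from `s 0`
  -- to `s i`. Beyond `s i`, region `i` no longer guarantees an optimum of `d i * k`.
  Blocked : ℕ → ℕ → ℕ → Set
  Blocked m i j = BlockedAt (s 0) m i j × BlockedAt (s i) m i j

  blocked-between : ∀ {m i j} → Blocked m i j → s 0 ≤ k → k ≤ s i → BlockedAt k m i j
  blocked-between {k} {m} {i} {j} (at-0 , at-i) s0≤k k≤si =
    backward k (linear-between p q p (p * b m + r) k s0≤k k≤si (forward (s 0) at-0) (forward (s i) at-i))
    where
    p = a * d m * d j
    q = c * d i * (d j + d m)
    r = c * d i * d m
    lhs : ∀ k → p * suc k ≡ p * k + p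
    lhs k = trans (*-suc p k) (+-comm p (p * k))
    rhs : ∀ k → p * b m + q * k + r ≡ q * k + (p * b m + r)
    rhs k = trans (cong (_+ r) (+-comm (p * b m) (q * k))) (+-assoc (q * k) (p * b m) r)
    forward : ∀ k → BlockedAt k m i j → p * k + p < q * k + (p * b m + r)
    forward k = subst₂ _<_ (lhs k) (rhs k)
    backward : ∀ k → p * k + p < q * k + (p * b m + r) → BlockedAt k m i j
    backward k = subst₂ _<_ (sym (lhs k)) (sym (rhs k))

  -- Scaling the first bound by `d j`, the second by `d m` and the element count by `a * d m * d j`
  -- clears all divisions; their combination reverses the blocking inequality.
  not-blocked : ∀ {m i j x y} → c * (d i * k) ≤ a * (d m * x) → c * (d i * suc k) ≤ a * (d j * y) →
    b m + x + y ≤ suc k → ¬ BlockedAt k m i j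
  not-blocked {k} {m} {i} {j} {x} {y} hx hy hxy blocked = <⇒≱ blocked (begin
    a * d m * d j * b m + c * d i * (d j + d m) * k + c * d i * d m
      ≡⟨ split a c (d m) (d i) (d j) (b m) k ⟩
    a * d m * d j * b m + d j * (c * (d i * k)) + d m * (c * (d i * suc k))
      ≤⟨ +-mono-≤ (+-monoʳ-≤ (a * d m * d j * b m) (*-monoʳ-≤ (d j) hx)) (*-monoʳ-≤ (d m) hy) ⟩
    a * d m * d j * b m + d j * (a * (d m * x)) + d m * (a * (d j * y))           ≡⟨ collect a (d m) (d j) (b m) x y ⟩
    a * d m * d j * (b m + x + y)                                                 ≤⟨ *-monoʳ-≤ (a * d m * d j) hxy ⟩
    a * d m * d j * suc k                                                         ∎)
    where
    open ≤-Reasoning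
    split : ∀ a c dm di dj bm k →
      a * dm * dj * bm + c * di * (dj + dm) * k + c * di * dm ≡
      a * dm * dj * bm + dj * (c * (di * k)) + dm * (c * (di * suc k))
    split = solve 7 (λ a c dm di dj bm k →
      a :* dm :* dj :* bm :+ c :* di :* (dj :+ dm) :* k :+ c :* di :* dm :=
      a :* dm :* dj :* bm :+ dj :* (c :* (di :* k)) :+ dm :* (c :* (di :* (con 1 :+ k)))) refl
      where open +-*-Solver
    collect : ∀ a dm dj bm x y →
      a * dm * dj * bm + dj * (a * (dm * x)) + dm * (a * (dj * y)) ≡ a * dm * dj * (bm + x + y)
    collect = solve 6 (λ a dm dj bm x y →
      a :* dm :* dj :* bm :+ dj :* (a :* (dm :* x)) :+ dm :* (a :* (dj :* y)) := a :* dm :* dj :* (bm :+ x :+ y)) refl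
      where open +-*-Solver

  -- The invariant along a trapping chain and its contradiction

  record IsTrap (M : ℕ) : Set where
    field
      b₀≡0         : b 0 ≡ 0
      d>0          : ∀ m → 0 < d m
      s₀>0         : 0 < s 0
      steep-start  : a * d 1 < c * d 0
      d-decreasing : ∀ {m} → m ≤ M → d (suc m) ≤ d m
      exhausted    : ∀ {m} → m ≤ M → a * (d m * s m) < c * (d (suc m) * s (suc m))
      -- With `x` the number of hits in region `m`, the premise is what serving at a time `k ≥ s m`
      -- yields once `d m` is cancelled.
      b-suc        : ∀ {m x} → c * s m ≤ a * x → b (suc m) ≤ b m + x
      -- The second index names the region that bounds the optimum from below: `m` for switches made
      -- before time `s m`, and the next region for the other switches, all of which occur before
      -- `s (suc m)`.
      no-early     : ∀ {m} → m < M → Blocked m m (suc m)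
      no-skip      : ∀ {m} → m < M → Blocked m (suc m) (2 + m)
      no-end       : Blocked M (suc M) (suc M)

  module _ {M : ℕ} (isTrap : IsTrap M) where
    open IsTrap isTrap
    open Regions (suc M) s d

    d-antitone : m ≤ n → n ≤ suc M → d n ≤ d m
    d-antitone {m} {n} m≤n n≤N with m≤n⇒m<n∨m≡n m≤n
    d-antitone             _ _   | inj₂ refl = ≤-refl
    d-antitone {n = suc n} _ n≤N | inj₁ m<n  =
      ≤-trans (d-decreasing (s≤s⁻¹ n≤N)) (d-antitone (s≤s⁻¹ m<n) (≤-trans (n≤1+n n) n≤N))

    -- `P k` abstracts the set of the first `k` elements of an order; the last hypothesis is
    -- competitiveness with ratio `a / c`.
    module _ (P : ℕ → 𝒫 ℕ) (grows : ∀ k u → u ∈ P k → u ∈ P (suc k))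
             (count-P≤ : ∀ k n → count (P k) n ≤ k)
             (competitive : ∀ k j → j ≤ suc M → c * capacity k j ≤ a * value (P k)) where

      Serves : ℕ → ℕ → Set
      Serves k m = ∀ i → i ≤ suc M → c * capacity k i ≤ a * worth (P k) m

      server : ∀ k → ∃[ m ] (m ≤ suc M × Serves k m)
      server k = let m , m≤N , e = maximum-attained (worth (P k)) (suc M) in
        m , m≤N , λ i i≤N → subst (λ v → c * capacity k i ≤ a * v) e (competitive k i i≤N)

      -- The bound is kept for all `n ≤ m`, because the serving region may later fall back to an
      -- earlier one.
      Invariant : ℕ → Set
      Invariant k = ∃[ m ] (m ≤ M × Serves k m × (∀ n → n ≤ m → b n ≤ count (P k) (offset n)))

      -- By `exhausted`, even the complete region `m` is worth too little once the optimum has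
      -- reached the full value of region `suc m`.
      serves⇒< : ∀ {m} → m ≤ M → Serves k m → k < s (suc m)
      serves⇒< {k} {m} m≤M serves = ≰⇒> λ s≤k → <⇒≱ (exhausted m≤M) (begin
        c * (d (suc m) * s (suc m))     ≡⟨ cong (λ x → c * (d (suc m) * x)) (m≥n⇒m⊓n≡n s≤k) ⟨
        c * capacity k (suc m)          ≤⟨ serves (suc m) (s≤s m≤M) ⟩
        a * worth (P k) m               ≤⟨ *-monoʳ-≤ a (*-monoʳ-≤ (d m) (count-≤ (P k ↑ offset m) (s m))) ⟩
        a * (d m * s m)                 ∎)
        where open ≤-Reasoning

      start : Invariant (s 0)
      start with server (s 0)
      ... | zero  , _   , serves = 0 , z≤n , serves , λ { zero z≤n → ≤-trans (≤-reflexive b₀≡0) z≤n }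
      -- A later region contains at most `s 0` of the chosen elements, each of density at most
      -- `d 1`, which is too little against a full region 0.
      ... | suc j , j≤N , serves = contradiction (begin
        c * (d 0 * s 0)                ≡⟨ cong (λ x → c * (d 0 * x)) (⊓-idem (s 0)) ⟨
        c * capacity (s 0) 0           ≤⟨ serves 0 z≤n ⟩
        a * worth (P (s 0)) (suc j)    ≤⟨ *-monoʳ-≤ a (*-mono-≤ (d-antitone (s≤s z≤n) j≤N)
                                            (≤-trans (hits≤count (P (s 0)) (suc j)) (count-P≤ (s 0) (offset (2 + j))))) ⟩
        a * (d 1 * s 0)                ∎) (<⇒≱ (begin-strict
        a * (d 1 * s 0)                ≡⟨ *-assoc a (d 1) (s 0) ⟨
        a * d 1 * s 0                  <⟨ *-monoˡ-< (s 0) {{>-nonZero s₀>0}} steep-start ⟩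
        c * d 0 * s 0                  ≡⟨ *-assoc c (d 0) (s 0) ⟩
        c * (d 0 * s 0)                ∎))
        where open ≤-Reasoning

      -- The elements before region `m`, those in region `m` and those in region `y` are disjoint
      -- parts of `P (suc k)`, so together they number at most `suc k`. Bounding `d y` by `d j` lets
      -- one condition on `j` exclude all sparser targets `y`.
      no-switch : ∀ {m i j y} → Blocked m i j → s 0 ≤ k → k < s i → i ≤ suc M →
        Serves k m → b m ≤ count (P k) (offset m) →
        Serves (suc k) y → m < y → d y ≤ d j → ⊥
      no-switch {k} {m} {i} {j} {y} blocked s0≤k k<si i≤N serves bm≤ serves′ m<y dy≤dj =
        not-blocked {k} {m} {i} {j} {hits (P k) m} {hits (P (suc k)) y}
          (subst (λ x → c * (d i * x) ≤ a * worth (P k) m) (m≤n⇒m⊓n≡m (<⇒≤ k<si)) (serves i i≤N))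
          (≤-trans (subst (λ x → c * (d i * x) ≤ a * worth (P (suc k)) y) (m≤n⇒m⊓n≡m k<si) (serves′ i i≤N))
                   (*-monoʳ-≤ a (*-monoˡ-≤ _ dy≤dj)))
          (begin
            b m + hits (P k) m + hits (P (suc k)) y                          ≤⟨ +-monoˡ-≤ _ (+-monoˡ-≤ _ bm≤) ⟩
            count (P k) (offset m) + hits (P k) m + hits (P (suc k)) y       ≡⟨ cong (_+ _) (count-offset (P k) m) ⟨
            count (P k) (offset (suc m)) + hits (P (suc k)) y
              ≤⟨ +-monoˡ-≤ _ (count-monoˡ (offset (suc m)) λ u _ → grows k u) ⟩
            count (P (suc k)) (offset (suc m)) + hits (P (suc k)) y
              ≤⟨ +-monoˡ-≤ _ (count-monoʳ (P (suc k)) (offset-mono m<y)) ⟩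
            count (P (suc k)) (offset y) + hits (P (suc k)) y                ≡⟨ count-offset (P (suc k)) y ⟨
            count (P (suc k)) (offset (suc y))                               ≤⟨ count-P≤ (suc k) (offset (suc y)) ⟩
            suc k                                                            ∎)
          (blocked-between {m = m} {i} {j} blocked s0≤k (<⇒≤ k<si))
        where open ≤-Reasoning

      persist : ∀ {n} → b n ≤ count (P k) (offset n) → b n ≤ count (P (suc k)) (offset n)
      persist {k} {n} bn≤ = ≤-trans bn≤ (count-monoˡ (offset n) λ u _ → grows k u)

      filled : ∀ {m} → m ≤ M → s m ≤ k → Serves k m → b m ≤ count (P k) (offset m) →
        b (suc m) ≤ count (P k) (offset (suc m))
      filled {k} {m} m≤M s≤k serves bm≤ = begin
        b (suc m)                                    ≤⟨ b-suc {m} {hits (P k) m} c*s≤ ⟩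
        b m + hits (P k) m                           ≤⟨ +-monoˡ-≤ _ bm≤ ⟩
        count (P k) (offset m) + hits (P k) m        ≡⟨ count-offset (P k) m ⟨
        count (P k) (offset (suc m))                 ∎
        where
        open ≤-Reasoning
        c*s≤ : c * s m ≤ a * hits (P k) m
        c*s≤ = *-cancelˡ-≤ (d m) {{>-nonZero (d>0 m)}} (begin
          d m * (c * s m)               ≡⟨ swap (d m) c (s m) ⟩
          c * (d m * s m)               ≡⟨ cong (λ x → c * (d m * x)) (m≥n⇒m⊓n≡n s≤k) ⟨
          c * capacity k m              ≤⟨ serves m (m≤n⇒m≤1+n m≤M) ⟩
          a * worth (P k) m             ≡⟨ swap (d m) a (hits (P k) m) ⟨
          d m * (a * hits (P k) m)      ∎)
          where
          swap : ∀ x y z → x * (y * z) ≡ y * (x * z)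
          swap = solve 3 (λ x y z → x :* (y :* z) := y :* (x :* z)) refl
            where open +-*-Solver

      step : s 0 ≤ k → Invariant k → Invariant (suc k)
      step {k} s0≤k (m , m≤M , serves , b≤) with server (suc k)
      ... | j , j≤N , serves′ with <-cmp j (suc m)
      ... | tri< j≤m _ _ = j , ≤-trans (s≤s⁻¹ j≤m) m≤M , serves′ ,
        λ n n≤j → persist (b≤ n (≤-trans n≤j (s≤s⁻¹ j≤m)))
      -- Densities do not increase along the chain, so `no-skip`, stated for region `2 + m`, also
      -- excludes every later target.
      ... | tri> _ _ m+2≤j = ⊥-elim (no-switch (no-skip (s≤s⁻¹ (≤-trans m+2≤j j≤N))) s0≤k (serves⇒< m≤M serves)
              (s≤s m≤M) serves (b≤ m ≤-refl) serves′ (≤-trans (n≤1+n _) m+2≤j) (d-antitone m+2≤j j≤N))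
      ... | tri≈ _ refl _ with m≤n⇒m<n∨m≡n m≤M
      ...   | inj₂ refl = ⊥-elim (no-switch no-end s0≤k (serves⇒< m≤M serves) ≤-refl serves (b≤ m ≤-refl) serves′ ≤-refl ≤-refl)
      ...   | inj₁ m<M with s m ≤? k
      ...     | no s≰k  = ⊥-elim (no-switch (no-early m<M) s0≤k (≰⇒> s≰k) (m≤n⇒m≤1+n m≤M) serves (b≤ m ≤-refl) serves′ ≤-refl ≤-refl)
      -- The only possible advance: region `m` serves at a time `k ≥ s m`, so it has absorbed enough
      -- elements for the bound at `suc m`.
      ...     | yes s≤k = suc m , m<M , serves′ , λ n n≤ → persist (extend n (m≤n⇒m<n∨m≡n n≤))
        where
        extend : ∀ n → n < suc m ⊎ n ≡ suc m → b n ≤ count (P k) (offset n)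
        extend n (inj₁ n≤m)  = b≤ n (s≤s⁻¹ n≤m)
        extend n (inj₂ refl) = filled m≤M s≤k serves (b≤ m ≤-refl)

      invariant : ∀ t → Invariant (t + s 0)
      invariant zero    = start
      invariant (suc t) = step (m≤n+m (s 0) t) (invariant t)

      trapped : ⊥
      -- At time `offset (2 + M) + s 0`, which is at least `s (suc M)`, no region `m ≤ M` can serve
      -- any more.
      trapped = let m , m≤M , serves , _ = invariant (offset (2 + M)) in
        <⇒≱ (serves⇒< m≤M serves) (≤-trans (s≤offset (s≤s (s≤s m≤M))) (m≤m+n (offset (2 + M)) (s 0)))

-- The concrete chain of 162 regions

record Stage : Set where
  constructor stage
  field
    -- `used` carries `s + b` of the preceding stage, so that a recurrence reaching back two stages
    -- can be run from a single one.
    s d b used : ℕ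

-- s (m+1) is a little more than 2.246² (s m - s (m-1) - b (m-1)), the least size for which skipping from
-- region m-1 to region m+1 is blocked, and d makes each region worth just over 2.246 times the previous one.
next : Stage → Stage
next (stage s d b used) = stage s′ (suc (2246 * d * s ℕ./ (1000 * s′))) (b + 1000 * s ℕ./ 2246) (s + b)
  where s′ = suc (50447 * (s ∸ used) ℕ./ 10000)

stages : ℕ → Stage
-- Large starting values keep the integer rounding harmless; the densities shrink along the chain
-- and therefore start far higher than the sizes.
stages zero    = stage (10 ^ 4) (10 ^ 24) 0 0
stages (suc m) = next (stages m)

s d b : ℕ → ℕ
s = Stage.s ∘ stages
d = Stage.d ∘ stages
b = Stage.b ∘ stages

open Chain 2246 1000 s d b using (Blocked; IsTrap; trapped)

blocked? : ∀ m i j → Dec (Blocked m i j)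
blocked? m i j = (_ <? _) ×-dec (_ <? _)

-- The sizes follow a linear recurrence with characteristic polynomial (q-1)q² - 2.246² (q-1)² + 2.246 (up to
-- rounding), which has complex roots near q = 2.85 because 2.246 is just below the critical ratio 2.24654.
-- Hence s (m+1) / s m keeps decreasing, slowly near 2.85, and after 160 steps region 161 is blocked.
isTrap : IsTrap 160
isTrap = record
  { b₀≡0         = refl
  ; d>0          = λ { zero → from-yes (0 <? d 0) ; (suc _) → z<s }
  ; s₀>0         = from-yes (0 <? s 0)
  ; steep-start  = from-yes (2246 * d 1 <? 1000 * d 0)
  ; d-decreasing = decreasing ∘ s≤s
  ; exhausted    = exhausting ∘ s≤s
  ; b-suc        = λ {m} → b-suc m
  ; no-early     = early
  ; no-skip      = skip
  ; no-end       = from-yes (blocked? 160 161 161)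
  }
  where
  decreasing : m < 161 → d (suc m) ≤ d m
  decreasing = from-yes (allUpTo? (λ m → d (suc m) ≤? d m) 161)
  exhausting : m < 161 → 2246 * (d m * s m) < 1000 * (d (suc m) * s (suc m))
  exhausting = from-yes (allUpTo? (λ m → 2246 * (d m * s m) <? 1000 * (d (suc m) * s (suc m))) 161)
  early : m < 160 → Blocked m m (suc m)
  early = from-yes (allUpTo? (λ m → blocked? m m (suc m)) 160)
  skip : m < 160 → Blocked m (suc m) (2 + m)
  skip = from-yes (allUpTo? (λ m → blocked? m (suc m) (2 + m)) 160)
  b-suc : ∀ m {x} → 1000 * s m ≤ 2246 * x → b (suc m) ≤ b m + x
  b-suc m {x} h = +-monoʳ-≤ (b m) (begin
    1000 * s m ℕ./ 2246      ≤⟨ /-monoˡ-≤ 2246 h ⟩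
    2246 * x ℕ./ 2246        ≡⟨ cong (ℕ._/ 2246) (*-comm 2246 x) ⟩
    x * 2246 ℕ./ 2246        ≡⟨ m*n/n≡m x 2246 ⟩
    x                        ∎)
    where open ≤-Reasoning

theorem4 : (α : ℝ) → α <ℝ fromℚ (+ 2246 / 1000) →
    ∃[ I ] (¬ (∃[ σ ] Instance.Competitive I α σ))
theorem4 α α< = regions , λ (σ , competitive) →
  trapped isTrap (Instance.prefix regions σ) (prefix-grows σ) (count-prefix-≤ σ)
    (capacity≤value-prefix σ α α< competitive)
  where open Regions 161 s d
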